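{- For every undirected social network $G(V,E,w)$ there exists a set $A \subseteq V$ such that the IE strategy $\mathrm{IE}(A, 0.586)$ satisfies $R_{\mathrm{IE}}(A, 0.586) \geq 0.9111 \cdot R_{\max}(G)$, where $R_{\max}(G)$ is the maximum revenue of $G$.
   Context: An undirected social network $G(V,E,w)$ on a finite set $V$ of $n$ buyers has real weights $w_{ij} = w_{ji} \geq 0$ for distinct $i,j \in V$ (positive exactly on the edges) and a weight $w_{ii} \geq 0$ for each $i \in V$. Marketing strategies (Uniform Additive Model). A marketing strategy $(\vec{\pi},\vec{p})$ consists of a permutation $\vec{\pi}$ of $V$ ($\pi_i$ is the position of buyer $i$) and a vector $\vec{p} = (p_i)_{i \in V}$ of pricing probabilities $p_i \in [1/2,1]$. Its expected revenue is $$R(\vec{\pi},\vec{p}) = \sum_{i\in V} p_i(1-p_i)\Big(w_{ii} + \sum_{j:\pi_j<\pi_i} p_j w_{ji}\Big).$$ The maximum revenue of $G$ is $R_{\max}(G) = \max_{(\vec{\pi},\vec{p})} R(\vec{\pi},\vec{p})$. Influence-and-Exploit (IE) strategies. For $A \subseteq V$ and $p \in [1/2,1)$, $\mathrm{IE}(A,p)$ first gives the product for free to the buyers in $A$ (pricing probability $1$) and then approaches the buyers in $V\setminus A$ in a uniformly random order with pricing probability $p$. Its expected revenue is $$R_{\mathrm{IE}}(A,p) = p(1-p)\sum_{i\in V\setminus A}\Big(w_{ii} + \sum_{j\in A} w_{ji} + \sum_{j\in V\setminus A,\ j\neq i} \frac{p\,w_{ji}}{2}\Big).$$ -}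

module Defs where

open import Algebra.Bundles using (CommutativeRing)
import Algebra.Definitions.RawMonoid as RawMonoidDefinitions
import Algebra.Properties.CommutativeSemigroup as CommutativeSemigroupProperties
import Algebra.Properties.Group as GroupProperties
import Algebra.Properties.Monoid.Sum as SumProperties
import Algebra.Properties.Ring as RingProperties
open import Data.Bool.Base using (Bool; true; false; if_then_else_)
open import Data.Fin.Base using (Fin; zero; suc; punchIn)
open import Data.Fin.Permutation as Perm using (Permutation′; _⟨$⟩ʳ_)
open import Data.Fin.Properties using (_≟_; _<?_)
open import Data.Fin.Subset using (Subset; ∁)
open import Data.Fin.Subset.Properties using (_∈?_)
open import Data.Nat.Base using (ℕ; zero; suc; NonZero)
open import Data.Product.Base using (Σ; ∃; _×_; _,_; proj₁; proj₂)
open import Data.Sum.Base using (inj₁; inj₂)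
open import Data.Vec.Functional using (Vector; _∷_; tail)
open import Function.Base using (_∘_; case_of_)
open import Level using (0ℓ)
open import Relation.Binary.Bundles using (Poset)
open import Relation.Binary.Core using (Rel)
open import Relation.Binary.PropositionalEquality.Core as ≡ using (_≡_)
import Relation.Binary.Reasoning.PartialOrder as PosetReasoning
open import Relation.Binary.Structures using (IsDecTotalOrder)
open import Relation.Nullary using (¬_; yes; no; does; ¬?; _×-dec_; contradiction)
open import Relation.Unary using (Pred; Decidable)

-- The real numbers, given axiomatically: classically any two complete ordered
-- fields are isomorphic.  The decidable order and the supremum axiom are those
-- of the classical reals (the constructive reals are not a model).

record CompleteOrderedField : Set₁ where
  infix  4 _≤_
  infix  8 _⁻¹
  infixl 7 _/_
  field
    commutativeRing : CommutativeRing 0ℓ 0ℓ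
  open CommutativeRing commutativeRing public hiding (zero)

  field
    0≉1             : ¬ 0# ≈ 1#
    -- total, with an unspecified value at 0#
    _⁻¹             : Carrier → Carrier
    ⁻¹-inverseʳ     : ∀ x → ¬ x ≈ 0# → x * x ⁻¹ ≈ 1#
    _≤_             : Rel Carrier 0ℓ
    isDecTotalOrder : IsDecTotalOrder _≈_ _≤_
    +-monoˡ-≤       : ∀ z {x y} → x ≤ y → x + z ≤ y + z
    *-nonneg        : ∀ {x y} → 0# ≤ x → 0# ≤ y → 0# ≤ x * y

  IsUpperBound : Pred Carrier 0ℓ → Carrier → Set
  IsUpperBound P b = ∀ x → P x → x ≤ b

  field
    supremum : (P : Pred Carrier 0ℓ) → ∃ P → ∃ (IsUpperBound P) →
               ∃ λ s → IsUpperBound P s × (∀ b → IsUpperBound P b → s ≤ b)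

  open RawMonoidDefinitions +-rawMonoid public
    using (sum) renaming (_×_ to _×ℕ_)

  _/_ : (m n : ℕ) .{{_ : NonZero n}} → Carrier
  m / n = (m ×ℕ 1#) * (n ×ℕ 1#) ⁻¹

  ∑-over : ∀ {n} {P : Pred (Fin n) 0ℓ} → Decidable P → (Fin n → Carrier) → Carrier
  ∑-over P? f = sum λ i → if does (P? i) then f i else 0#

  IsMaximum : {A : Set} → (A → Carrier) → Carrier → Set
  IsMaximum f x = (∃ λ a → f a ≈ x) × (∀ a → f a ≤ x)


-- The edges are the pairs of distinct buyers of nonzero weight, so the weights
-- carry the whole network; the diagonal entry w i i is the weight of buyer i.

record SocialNetwork (ℝ : CompleteOrderedField) (n : ℕ) : Set where
  open CompleteOrderedField ℝ
  field
    w        : Fin n → Fin n → Carrier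
    w-sym    : ∀ i j → w i j ≈ w j i
    w-nonneg : ∀ i j → 0# ≤ w i j


module Revenue (ℝ : CompleteOrderedField) where
  open CompleteOrderedField ℝ

  ValidPrice : Pred Carrier 0ℓ
  ValidPrice x = 1 / 2 ≤ x × x ≤ 1#

  record Strategy (n : ℕ) : Set where
    constructor strategy
    field
      π     : Permutation′ n
      p     : Vector Carrier n
      valid : ∀ i → ValidPrice (p i)

  module _ {n} (G : SocialNetwork ℝ n) where
    open SocialNetwork G

    revenue′ : Permutation′ n → Vector Carrier n → Carrier
    revenue′ π p = sum λ i → p i * (1# - p i) *
      (w i i + ∑-over (λ j → (π ⟨$⟩ʳ j) <? (π ⟨$⟩ʳ i)) (λ j → p j * w j i))

    R : Strategy n → Carrier
    R s = revenue′ π p where open Strategy s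

    -- 1 / 2 is the probability that j precedes i in a uniformly random order.
    R-IE : Subset n → Carrier → Carrier
    R-IE A p = p * (1# - p) * ∑-over (_∈? ∁ A) λ i →
      w i i
      + ∑-over (_∈? A) (λ j → w j i)
      + ∑-over (λ j → (j ∈? ∁ A) ×-dec ¬? (j ≟ i)) (λ j → p * w j i * (1 / 2))


-- Existence of a maximum of the revenue: the revenue is Lipschitz on the box
-- of valid prices, where maxima are found one coordinate at a time, and there
-- are finitely many permutations.

module MaximumExists (ℝ : CompleteOrderedField) where
  open CompleteOrderedField ℝ
  open Revenue ℝ
  open IsDecTotalOrder isDecTotalOrder
    using (_≤?_; total; antisym; isPartialOrder)
    renaming (refl to ≤-refl; trans to ≤-trans; reflexive to ≤-reflexive)
  open RingProperties ring using (-1*x≈-x)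
  open GroupProperties +-group using () renaming (⁻¹-involutive to -‿involutive)
  open CommutativeSemigroupProperties +-commutativeSemigroup
    using (interchange)
  open SumProperties +-monoid using (sum-cong-≗)

  private
    poset : Poset 0ℓ 0ℓ 0ℓ
    poset = record { isPartialOrder = isPartialOrder }

  open PosetReasoning poset using (begin_; step-≤; step-≈-⟩; step-≈-⟨; _∎)

  private
    infix 4 _<_
    _<_ : Rel Carrier 0ℓ
    x < y = ¬ y ≤ x

    <⇒≤ : ∀ {x y} → x < y → x ≤ y
    <⇒≤ {x} {y} x<y with total x y
    ... | inj₁ x≤y = x≤y
    ... | inj₂ y≤x = contradiction y≤x x<y

    +-monoʳ-≤ : ∀ z {x y} → x ≤ y → z + x ≤ z + y
    +-monoʳ-≤ z {x} {y} x≤y = begin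
      z + x  ≈⟨ +-comm z x ⟩
      x + z  ≤⟨ +-monoˡ-≤ z x≤y ⟩
      y + z  ≈⟨ +-comm y z ⟩
      z + y  ∎

    +-mono-≤ : ∀ {x y u v} → x ≤ y → u ≤ v → x + u ≤ y + v
    +-mono-≤ x≤y u≤v = ≤-trans (+-monoˡ-≤ _ x≤y) (+-monoʳ-≤ _ u≤v)

    +-nonneg : ∀ {x y} → 0# ≤ x → 0# ≤ y → 0# ≤ x + y
    +-nonneg 0≤x 0≤y = ≤-trans (≤-reflexive (sym (+-identityˡ 0#))) (+-mono-≤ 0≤x 0≤y)

    x+y-y≈x : ∀ x y → x + y - y ≈ x
    x+y-y≈x x y = trans (+-assoc x y (- y)) (trans (+-congˡ (-‿inverseʳ y)) (+-identityʳ x))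

    x-y+y≈x : ∀ x y → x - y + y ≈ x
    x-y+y≈x x y = trans (+-assoc x (- y) y) (trans (+-congˡ (-‿inverseˡ y)) (+-identityʳ x))

    +-cancelʳ-≤ : ∀ z {x y} → x + z ≤ y + z → x ≤ y
    +-cancelʳ-≤ z {x} {y} h = begin
      x          ≈⟨ x+y-y≈x x z ⟨
      x + z - z  ≤⟨ +-monoˡ-≤ (- z) h ⟩
      y + z - z  ≈⟨ x+y-y≈x y z ⟩
      y          ∎

    0≤y-x : ∀ {x y} → x ≤ y → 0# ≤ y - x
    0≤y-x {x} {y} x≤y = begin
      0#     ≈⟨ -‿inverseʳ x ⟨
      x - x  ≤⟨ +-monoˡ-≤ (- x) x≤y ⟩
      y - x  ∎

    x≤x+y : ∀ {x y} → 0# ≤ y → x ≤ x + y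
    x≤x+y {x} 0≤y = ≤-trans (≤-reflexive (sym (+-identityʳ x))) (+-monoʳ-≤ x 0≤y)

    x+y≰x : ∀ {x y} → 0# < y → ¬ x + y ≤ x
    x+y≰x {x} {y} 0<y h = 0<y (+-cancelʳ-≤ x (begin
      y + x   ≈⟨ +-comm y x ⟩
      x + y   ≤⟨ h ⟩
      x       ≈⟨ +-identityˡ x ⟨
      0# + x  ∎))

    *-monoʳ-≤ : ∀ {z x y} → 0# ≤ z → x ≤ y → z * x ≤ z * y
    *-monoʳ-≤ {z} {x} {y} 0≤z x≤y = begin
      z * x                ≤⟨ x≤x+y (*-nonneg 0≤z (0≤y-x x≤y)) ⟩
      z * x + z * (y - x)  ≈⟨ distribˡ z x (y - x) ⟨
      z * (x + (y - x))    ≈⟨ *-congˡ (trans (+-comm x (y - x)) (x-y+y≈x y x)) ⟩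
      z * y                ∎

    *-monoˡ-≤ : ∀ {z x y} → 0# ≤ z → x ≤ y → x * z ≤ y * z
    *-monoˡ-≤ {z} {x} {y} 0≤z x≤y = begin
      x * z  ≈⟨ *-comm x z ⟩
      z * x  ≤⟨ *-monoʳ-≤ 0≤z x≤y ⟩
      z * y  ≈⟨ *-comm z y ⟩
      y * z  ∎

    0≤1 : 0# ≤ 1#
    0≤1 with total 0# 1#
    ... | inj₁ h = h
    ... | inj₂ h = begin
      0#             ≤⟨ *-nonneg 0≤-1 0≤-1 ⟩
      - 1# * - 1#    ≈⟨ -1*x≈-x (- 1#) ⟩
      - - 1#         ≈⟨ -‿involutive 1# ⟩
      1#             ∎
      where
      0≤-1 : 0# ≤ - 1#
      0≤-1 = ≤-trans (0≤y-x h) (≤-reflexive (+-identityˡ (- 1#)))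

    0<1 : 0# < 1#
    0<1 1≤0 = 0≉1 (antisym 0≤1 1≤0)

    0<⇒≉0 : ∀ {x} → 0# < x → ¬ x ≈ 0#
    0<⇒≉0 0<x x≈0 = 0<x (≤-reflexive x≈0)

    0<⁻¹ : ∀ {x} → 0# < x → 0# < x ⁻¹
    0<⁻¹ {x} 0<x h = 0<1 (begin
      1#        ≈⟨ ⁻¹-inverseʳ x (0<⇒≉0 0<x) ⟨
      x * x ⁻¹  ≤⟨ *-monoʳ-≤ (<⇒≤ 0<x) h ⟩
      x * 0#    ≈⟨ zeroʳ x ⟩
      0#        ∎)

    *-pos : ∀ {x y} → 0# < x → 0# < y → 0# < x * y
    *-pos {x} {y} 0<x 0<y h = 0<y (begin
      y               ≈⟨ *-identityˡ y ⟨
      1# * y          ≈⟨ *-congʳ (trans (*-comm (x ⁻¹) x) (⁻¹-inverseʳ x (0<⇒≉0 0<x))) ⟨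
      x ⁻¹ * x * y    ≈⟨ *-assoc (x ⁻¹) x y ⟩
      x ⁻¹ * (x * y)  ≤⟨ *-monoʳ-≤ (<⇒≤ (0<⁻¹ 0<x)) h ⟩
      x ⁻¹ * 0#       ≈⟨ zeroʳ (x ⁻¹) ⟩
      0#              ∎)

    x<x+1 : ∀ {x} → 0# ≤ x → 0# < x + 1#
    x<x+1 {x} 0≤x h = 0<1 (begin
      1#       ≈⟨ +-identityˡ 1# ⟨
      0# + 1#  ≤⟨ +-monoˡ-≤ 1# 0≤x ⟩
      x + 1#   ≤⟨ h ⟩
      0#       ∎)

    ½ : Carrier
    ½ = 1 / 2

    2≈1+1 : 2 ×ℕ 1# ≈ 1# + 1#
    2≈1+1 = +-congˡ (+-identityʳ 1#)

    0<2 : 0# < 2 ×ℕ 1#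
    0<2 h = x<x+1 0≤1 (≤-trans (≤-reflexive (sym 2≈1+1)) h)

    ½≈2⁻¹ : ½ ≈ (2 ×ℕ 1#) ⁻¹
    ½≈2⁻¹ = trans (*-congʳ (+-identityʳ 1#)) (*-identityˡ _)

    0<½ : 0# < ½
    0<½ h = 0<⁻¹ 0<2 (≤-trans (≤-reflexive (sym ½≈2⁻¹)) h)

    ½+½≈1 : ½ + ½ ≈ 1#
    ½+½≈1 = trans (+-cong (sym (*-identityˡ ½)) (sym (*-identityˡ ½)))
      (trans (sym (distribʳ ½ 1# 1#))
      (trans (*-cong (sym 2≈1+1) ½≈2⁻¹) (⁻¹-inverseʳ _ (0<⇒≉0 0<2))))

    ½≤1 : ½ ≤ 1#
    ½≤1 = ≤-trans (x≤x+y (<⇒≤ 0<½)) (≤-reflexive ½+½≈1)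

    valid⇒0≤ : ∀ {x} → ValidPrice x → 0# ≤ x
    valid⇒0≤ (½≤x , _) = ≤-trans (<⇒≤ 0<½) ½≤x

  Near : Carrier → Rel Carrier 0ℓ
  Near δ x y = x ≤ y + δ × y ≤ x + δ

  module OneDimensional
    (g : ∀ x → ValidPrice x → Carrier) (B L : Carrier) (0≤L : 0# ≤ L)
    (g≤B : ∀ x v → g x v ≤ B)
    (lip : ∀ {δ x y} v v′ → 0# ≤ δ → Near δ x y → g x v ≤ g y v′ + L * δ)
    where

    private
      Image : Pred Carrier 0ℓ
      Image z = ∃ λ x → Σ (ValidPrice x) λ v → z ≈ g x v

      image-sup : ∃ λ s → IsUpperBound Image s × (∀ b → IsUpperBound Image b → s ≤ b)
      image-sup = supremum Image (_ , ½ , (≤-refl , ½≤1) , refl)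
        (B , λ { z (x , v , z≈) → ≤-trans (≤-reflexive z≈) (g≤B x v) })

      M : Carrier
      M = proj₁ image-sup

      g≤M : ∀ x v → g x v ≤ M
      g≤M x v = proj₁ (proj₂ image-sup) (g x v) (x , v , refl)

      BelowBy : Carrier → Pred Carrier 0ℓ
      BelowBy ε x = ∀ y v → y < x → g y v + ε ≤ M

      notBelow : ∀ ε → 0# < ε → ¬ (∀ y v → g y v + ε ≤ M)
      notBelow ε 0<ε h = x+y≰x 0<ε M+ε≤M
        where
        M≤M-ε : M ≤ M - ε
        M≤M-ε = proj₂ (proj₂ image-sup) (M - ε) λ { z (x , v , z≈) →
          +-cancelʳ-≤ ε (begin
            z + ε        ≈⟨ +-congʳ z≈ ⟩
            g x v + ε    ≤⟨ h x v ⟩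
            M            ≈⟨ x-y+y≈x M ε ⟨
            M - ε + ε    ∎) }
        M+ε≤M : M + ε ≤ M
        M+ε≤M = ≤-trans (+-monoˡ-≤ ε M≤M-ε) (≤-reflexive (x-y+y≈x M ε))

      Slack : Pred Carrier 0ℓ
      Slack x = ValidPrice x × ∃ λ ε → 0# < ε × BelowBy ε x

      slack-½ : Slack ½
      slack-½ = (≤-refl , ½≤1) , 1# , 0<1 , λ y v y<½ → contradiction (proj₁ v) y<½

      slack-sup : ∃ λ s → IsUpperBound Slack s × (∀ b → IsUpperBound Slack b → s ≤ b)
      slack-sup = supremum Slack (½ , slack-½) (1# , λ _ s → proj₂ (proj₁ s))

      c : Carrier
      c = proj₁ slack-sup

      slack≤c : IsUpperBound Slack c
      slack≤c = proj₁ (proj₂ slack-sup)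

      c-valid : ValidPrice c
      c-valid = slack≤c ½ slack-½ , proj₂ (proj₂ slack-sup) 1# λ _ s → proj₂ (proj₁ s)

    module _ (gc<M : g c c-valid < M) where
      private
        gc e K δ : Carrier
        gc = g c c-valid
        e = (M - gc) * ½
        K = L + 1#
        δ = e * K ⁻¹

        0<e : 0# < e
        0<e = *-pos (λ h → gc<M (≤-trans (≤-reflexive (sym (x-y+y≈x M gc)))
                (≤-trans (+-monoˡ-≤ gc h) (≤-reflexive (+-identityˡ gc))))) 0<½

        gc+e+e≈M : gc + e + e ≈ M
        gc+e+e≈M = trans (+-assoc gc e e)
          (trans (+-congˡ (trans (sym (distribˡ (M - gc) ½ ½))
            (trans (*-congˡ ½+½≈1) (*-identityʳ _))))
          (trans (+-comm gc (M - gc)) (x-y+y≈x M gc)))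

        0<K : 0# < K
        0<K = x<x+1 0≤L

        0<δ : 0# < δ
        0<δ = *-pos 0<e (0<⁻¹ 0<K)

        Lδ≤e : L * δ ≤ e
        Lδ≤e = begin
          L * δ             ≤⟨ *-monoˡ-≤ (<⇒≤ 0<δ) (x≤x+y 0≤1) ⟩
          K * (e * K ⁻¹)    ≈⟨ *-comm K _ ⟩
          e * K ⁻¹ * K      ≈⟨ *-assoc e _ K ⟩
          e * (K ⁻¹ * K)    ≈⟨ *-congˡ (trans (*-comm _ K) (⁻¹-inverseʳ K (0<⇒≉0 0<K))) ⟩
          e * 1#            ≈⟨ *-identityʳ e ⟩
          e                 ∎

        near : ∀ y v → y ≤ c + δ → c ≤ y + δ → g y v + e ≤ M
        near y v y≤ c≤ = begin
          g y v + e         ≤⟨ +-monoˡ-≤ e (lip v c-valid (<⇒≤ 0<δ) (y≤ , c≤)) ⟩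
          gc + L * δ + e    ≤⟨ +-monoˡ-≤ e (+-monoʳ-≤ gc Lδ≤e) ⟩
          gc + e + e        ≈⟨ gc+e+e≈M ⟩
          M                 ∎

        noSlackBeyond : ∀ ε → 0# < ε → ¬ BelowBy ε (c + δ)
        noSlackBeyond ε 0<ε below = case c + δ ≤? 1# of λ where
          (yes c+δ≤1) → x+y≰x 0<δ (slack≤c (c + δ)
                (( ≤-trans (proj₁ c-valid) (x≤x+y (<⇒≤ 0<δ)) , c+δ≤1) , ε , 0<ε , below))
          (no  c+δ≰1) → notBelow ε 0<ε λ y v →
                below y v λ c+δ≤y → c+δ≰1 (≤-trans c+δ≤y (proj₂ v))

        extend : ∀ s ε → s ≤ c → c < s + δ → ε ≤ e → BelowBy ε s → BelowBy ε (c + δ)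
        extend s ε s≤c c<s+δ ε≤e below y v y<c+δ = case s ≤? y of λ where
          (no  s≰y) → below y v s≰y
          (yes s≤y) → ≤-trans (+-monoʳ-≤ (g y v) ε≤e)
                (near y v (<⇒≤ y<c+δ) (≤-trans (<⇒≤ c<s+δ) (+-monoˡ-≤ δ s≤y)))

        noSlackNear : ∀ s → Slack s → ¬ c < s + δ
        noSlackNear s sl@(_ , ε , 0<ε , below) c<s+δ = case ε ≤? e of λ where
          (yes ε≤e) → noSlackBeyond ε 0<ε (extend s ε (slack≤c s sl) c<s+δ ε≤e below)
          (no  ε≰e) → noSlackBeyond e 0<e (extend s e (slack≤c s sl) c<s+δ ≤-refl
                λ y v y<s → ≤-trans (+-monoʳ-≤ (g y v) (<⇒≤ ε≰e)) (below y v y<s))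

        s+δ≤c : ∀ s → Slack s → s + δ ≤ c
        s+δ≤c s sl = case s + δ ≤? c of λ where
          (yes h) → h
          (no  h) → contradiction h (noSlackNear s sl)

      absurd : ¬ Slack ½
      absurd _ = x+y≰x 0<δ (≤-trans (+-monoˡ-≤ δ (proj₂ (proj₂ slack-sup) (c - δ) λ s sl →
        +-cancelʳ-≤ δ (≤-trans (s+δ≤c s sl) (≤-reflexive (sym (x-y+y≈x c δ))))))
        (≤-reflexive (x-y+y≈x c δ)))

    maximum : ∃ λ x → Σ (ValidPrice x) λ v → ∀ y v′ → g y v′ ≤ g x v
    maximum = case M ≤? g c c-valid of λ where
      (yes M≤gc) → c , c-valid , λ y v′ → ≤-trans (g≤M y v′) M≤gc
      (no  M≰gc) → contradiction slack-½ (absurd M≰gc)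

  Box : ∀ {n} → Pred (Vector Carrier n) 0ℓ
  Box p = ∀ i → ValidPrice (p i)

  NearAll : ∀ {n} → Carrier → Rel (Vector Carrier n) 0ℓ
  NearAll δ p q = ∀ i → Near δ (p i) (q i)

  record Tame {n} (f : Vector Carrier n → Carrier) : Set where
    field
      B L    : Carrier
      0≤B    : 0# ≤ B
      0≤L    : 0# ≤ L
      nonneg : ∀ p → Box p → 0# ≤ f p
      f≤B    : ∀ p → Box p → f p ≤ B
      lip    : ∀ {δ} p q → Box p → Box q → 0# ≤ δ → NearAll δ p q → f p ≤ f q + L * δ

  private
    x+L0≈x : ∀ x L → x + L * 0# ≈ x
    x+L0≈x x L = trans (+-congˡ (zeroʳ L)) (+-identityʳ x)

    near-refl : ∀ {δ x} → 0# ≤ δ → Near δ x x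
    near-refl 0≤δ = x≤x+y 0≤δ , x≤x+y 0≤δ

    consBox : ∀ {n x} {p : Vector Carrier n} → ValidPrice x → Box p → Box (x ∷ p)
    consBox v b zero    = v
    consBox v b (suc i) = b i

    consNear : ∀ {n δ x y} {p q : Vector Carrier n} →
               Near δ x y → NearAll δ p q → NearAll δ (x ∷ p) (y ∷ q)
    consNear h hs zero    = h
    consNear h hs (suc i) = hs i

  boxMaximum : ∀ {n} (f : Vector Carrier n → Carrier) → Tame f →
               ∃ λ p → Box p × (∀ q → Box q → f q ≤ f p)
  boxMaximum {zero} f t = (λ ()) , (λ ()) , λ q b →
    ≤-trans (lip q (λ ()) b (λ ()) ≤-refl (λ ())) (≤-reflexive (x+L0≈x _ L))
    where open Tame t
  boxMaximum {suc n} f t = x∷y , x∷y-box , λ q b → begin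
      f q                           ≤⟨ lip q _ b (q-box b) ≤-refl (η-near q) ⟩
      f (q zero ∷ tail q) + L * 0#  ≈⟨ x+L0≈x _ L ⟩
      f (q zero ∷ tail q)           ≤⟨ proj₂ (proj₂ (best (q zero) (b zero))) (tail q) (b ∘ suc) ⟩
      g (q zero) (b zero)           ≤⟨ proj₂ (proj₂ top) (q zero) (b zero) ⟩
      f x∷y                         ∎
    where
    open Tame t
    best : ∀ x → ValidPrice x →
           ∃ λ p → Box p × (∀ q → Box q → f (x ∷ q) ≤ f (x ∷ p))
    best x v = boxMaximum (λ p → f (x ∷ p)) record
      { B = B ; L = L ; 0≤B = 0≤B ; 0≤L = 0≤L
      ; nonneg = λ p b → nonneg _ (consBox v b)
      ; f≤B    = λ p b → f≤B _ (consBox v b)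
      ; lip    = λ p q b b′ 0≤δ h →
          lip _ _ (consBox v b) (consBox v b′) 0≤δ (consNear (near-refl 0≤δ) h)
      }
    g : ∀ x → ValidPrice x → Carrier
    g x v = f (x ∷ proj₁ (best x v))
    g-lip : ∀ {δ x y} v v′ → 0# ≤ δ → Near δ x y → g x v ≤ g y v′ + L * δ
    g-lip {δ} {x} {y} v v′ 0≤δ h with best x v | best y v′
    ... | p , b , _ | p′ , _ , above = ≤-trans
      (lip (x ∷ p) (y ∷ p) (consBox v b) (consBox v′ b) 0≤δ (consNear h λ _ → near-refl 0≤δ))
      (+-monoˡ-≤ (L * δ) (above p b))
    top : ∃ λ x → Σ (ValidPrice x) λ v → ∀ y v′ → g y v′ ≤ g x v
    top = OneDimensional.maximum g B L 0≤L
      (λ x v → f≤B _ (consBox v (proj₁ (proj₂ (best x v))))) g-lip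
    x∷y : Vector Carrier (suc n)
    x∷y = proj₁ top ∷ proj₁ (best (proj₁ top) (proj₁ (proj₂ top)))
    x∷y-box : Box x∷y
    x∷y-box = consBox (proj₁ (proj₂ top)) (proj₁ (proj₂ (best (proj₁ top) (proj₁ (proj₂ top)))))
    q-box : ∀ {q} → Box q → Box (q zero ∷ tail q)
    q-box b = consBox (b zero) (b ∘ suc)
    η-near : ∀ q → NearAll 0# q (q zero ∷ tail q)
    η-near q zero    = near-refl ≤-refl
    η-near q (suc i) = near-refl ≤-refl

  private
    tame-const : ∀ {n} {x} → 0# ≤ x → Tame {n} (λ _ → x)
    tame-const {x = x} 0≤x = record
      { B = x ; L = 0# ; 0≤B = 0≤x ; 0≤L = ≤-refl
      ; nonneg = λ _ _ → 0≤x ; f≤B = λ _ _ → ≤-refl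
      ; lip = λ _ _ _ _ 0≤δ _ → x≤x+y (*-nonneg ≤-refl 0≤δ) }

    tame-p : ∀ {n} (i : Fin n) → Tame (λ p → p i)
    tame-p i = record
      { B = 1# ; L = 1# ; 0≤B = 0≤1 ; 0≤L = 0≤1
      ; nonneg = λ p b → valid⇒0≤ (b i)
      ; f≤B = λ p b → proj₂ (b i)
      ; lip = λ p q _ _ _ h →
          ≤-trans (proj₁ (h i)) (≤-reflexive (+-congˡ (sym (*-identityˡ _)))) }

    tame-1-p : ∀ {n} (i : Fin n) → Tame (λ p → 1# - p i)
    tame-1-p i = record
      { B = 1# ; L = 1# ; 0≤B = 0≤1 ; 0≤L = 0≤1
      ; nonneg = λ p b → 0≤y-x (proj₂ (b i))
      ; f≤B = λ p b → ≤-trans (x≤x+y (valid⇒0≤ (b i))) (≤-reflexive (x-y+y≈x 1# (p i)))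
      ; lip = λ {δ} p q _ _ _ h → +-cancelʳ-≤ (p i) (begin
          1# - p i + p i              ≈⟨ x-y+y≈x 1# (p i) ⟩
          1#                          ≈⟨ x-y+y≈x 1# (q i) ⟨
          1# - q i + q i              ≤⟨ +-monoʳ-≤ (1# - q i) (proj₂ (h i)) ⟩
          1# - q i + (p i + δ)        ≈⟨ +-congˡ (+-comm (p i) δ) ⟩
          1# - q i + (δ + p i)        ≈⟨ +-assoc _ δ (p i) ⟨
          1# - q i + δ + p i          ≈⟨ +-congʳ (+-congˡ (*-identityˡ δ)) ⟨
          1# - q i + 1# * δ + p i     ∎) }

    tame-+ : ∀ {n} {f g : Vector Carrier n → Carrier} →
             Tame f → Tame g → Tame (λ p → f p + g p)
    tame-+ {f = f} {g} s t = record
      { B = S.B + T.B ; L = S.L + T.L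
      ; 0≤B = +-nonneg S.0≤B T.0≤B ; 0≤L = +-nonneg S.0≤L T.0≤L
      ; nonneg = λ p b → +-nonneg (S.nonneg p b) (T.nonneg p b)
      ; f≤B = λ p b → +-mono-≤ (S.f≤B p b) (T.f≤B p b)
      ; lip = λ {δ} p q b b′ 0≤δ h → begin
          f p + g p                                ≤⟨ +-mono-≤ (S.lip p q b b′ 0≤δ h) (T.lip p q b b′ 0≤δ h) ⟩
          (f q + S.L * δ) + (g q + T.L * δ)        ≈⟨ interchange (f q) _ (g q) _ ⟩
          (f q + g q) + (S.L * δ + T.L * δ)        ≈⟨ +-congˡ (distribʳ δ S.L T.L) ⟨
          (f q + g q) + (S.L + T.L) * δ            ∎ }
      where
      module S = Tame s
      module T = Tame t

    tame-* : ∀ {n} {f g : Vector Carrier n → Carrier} →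
             Tame f → Tame g → Tame (λ p → f p * g p)
    tame-* {f = f} {g} s t = record
      { B = S.B * T.B ; L = T.B * S.L + S.B * T.L
      ; 0≤B = *-nonneg S.0≤B T.0≤B
      ; 0≤L = +-nonneg (*-nonneg T.0≤B S.0≤L) (*-nonneg S.0≤B T.0≤L)
      ; nonneg = λ p b → *-nonneg (S.nonneg p b) (T.nonneg p b)
      ; f≤B = λ p b → ≤-trans (*-monoˡ-≤ (T.nonneg p b) (S.f≤B p b)) (*-monoʳ-≤ S.0≤B (T.f≤B p b))
      ; lip = λ {δ} p q b b′ 0≤δ h → begin
          f p * g p
            ≤⟨ *-monoʳ-≤ (S.nonneg p b) (T.lip p q b b′ 0≤δ h) ⟩
          f p * (g q + T.L * δ)
            ≈⟨ distribˡ (f p) (g q) _ ⟩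
          f p * g q + f p * (T.L * δ)
            ≤⟨ +-mono-≤ (*-monoˡ-≤ (T.nonneg q b′) (S.lip p q b b′ 0≤δ h))
                        (*-monoˡ-≤ (*-nonneg T.0≤L 0≤δ) (S.f≤B p b)) ⟩
          (f q + S.L * δ) * g q + S.B * (T.L * δ)
            ≈⟨ +-congʳ (distribʳ (g q) (f q) _) ⟩
          f q * g q + S.L * δ * g q + S.B * (T.L * δ)
            ≤⟨ +-monoˡ-≤ _ (+-monoʳ-≤ _ (*-monoʳ-≤ (*-nonneg S.0≤L 0≤δ) (T.f≤B q b′))) ⟩
          f q * g q + S.L * δ * T.B + S.B * (T.L * δ)
            ≈⟨ +-assoc _ _ _ ⟩
          f q * g q + (S.L * δ * T.B + S.B * (T.L * δ))
            ≈⟨ +-congˡ (+-cong (trans (*-comm _ T.B) (sym (*-assoc T.B S.L δ))) (sym (*-assoc S.B T.L δ))) ⟩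
          f q * g q + (T.B * S.L * δ + S.B * T.L * δ)
            ≈⟨ +-congˡ (distribʳ δ _ _) ⟨
          f q * g q + (T.B * S.L + S.B * T.L) * δ
            ∎ }
      where
      module S = Tame s
      module T = Tame t

    tame-sum : ∀ {n} m {f : Fin m → Vector Carrier n → Carrier} →
               (∀ i → Tame (f i)) → Tame (λ p → sum λ i → f i p)
    tame-sum zero    t = tame-const ≤-refl
    tame-sum (suc m) t = tame-+ (t zero) (tame-sum m (t ∘ suc))

    tame-if : ∀ {n} (b : Bool) {f : Vector Carrier n → Carrier} →
              Tame f → Tame (λ p → if b then f p else 0#)
    tame-if true  t = t
    tame-if false t = tame-const ≤-refl

  finMaximum : ∀ {n} (f : Fin (suc n) → Carrier) → ∃ λ i → ∀ j → f j ≤ f i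
  finMaximum {zero}  f = zero , λ { zero → ≤-refl }
  finMaximum {suc n} f with finMaximum (f ∘ suc)
  ... | i , above with f zero ≤? f (suc i)
  ...   | yes h = suc i , λ { zero → h ; (suc j) → above j }
  ...   | no  h = zero  , λ { zero → ≤-refl ; (suc j) → ≤-trans (above j) (<⇒≤ h) }

  private
    insert-cong : ∀ {n} j {π σ : Permutation′ n} → π Perm.≈ σ →
                  Perm.insert zero j π Perm.≈ Perm.insert zero j σ
    insert-cong j π≈σ zero = ≡.refl
    insert-cong j {π} {σ} π≈σ (suc k) = ≡.trans (Perm.insert-punchIn zero j π k)
      (≡.trans (≡.cong (punchIn j) (π≈σ k))
               (≡.sym (Perm.insert-punchIn zero j σ k)))

  permMaximum : ∀ {n} (f : Permutation′ n → Carrier) →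
                (∀ π σ → π Perm.≈ σ → f π ≤ f σ) → ∃ λ π → ∀ σ → f σ ≤ f π
  permMaximum {zero}  f f-cong = Perm.id , λ σ → f-cong σ Perm.id λ ()
  permMaximum {suc n} f f-cong = insert j (ρ j) , λ σ → begin
      f σ                                             ≤⟨ f-cong _ _ (≡.sym ∘ Perm.insert-remove zero σ) ⟩
      f (insert (σ ⟨$⟩ʳ zero) (Perm.remove zero σ))   ≤⟨ proj₂ (best (σ ⟨$⟩ʳ zero)) _ ⟩
      f (insert (σ ⟨$⟩ʳ zero) (ρ (σ ⟨$⟩ʳ zero)))      ≤⟨ proj₂ top (σ ⟨$⟩ʳ zero) ⟩
      f (insert j (ρ j))                              ∎
    where
    insert : Fin (suc n) → Permutation′ n → Permutation′ (suc n)
    insert = Perm.insert zero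
    best : ∀ j → ∃ λ ρ → ∀ σ → f (insert j σ) ≤ f (insert j ρ)
    best j = permMaximum (λ ρ → f (insert j ρ))
      λ π σ π≈σ → f-cong _ _ (insert-cong j {π} {σ} π≈σ)
    ρ : Fin (suc n) → Permutation′ n
    ρ j = proj₁ (best j)
    top : ∃ λ j → ∀ k → f (insert k (ρ k)) ≤ f (insert j (ρ j))
    top = finMaximum λ j → f (insert j (ρ j))
    j : Fin (suc n)
    j = proj₁ top

  module _ {n} (G : SocialNetwork ℝ n) where
    open SocialNetwork G

    private
      tame-revenue : ∀ π → Tame (revenue′ G π)
      tame-revenue π = tame-sum n λ i →
        tame-* (tame-* (tame-p i) (tame-1-p i))
               (tame-+ (tame-const (w-nonneg i i)) (tame-sum n λ j →
                 tame-if (does ((π ⟨$⟩ʳ j) <? (π ⟨$⟩ʳ i)))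
                         (tame-* (tame-p j) (tame-const (w-nonneg j i)))))

      revenue-cong : ∀ π σ → π Perm.≈ σ → ∀ p → revenue′ G π p ≡ revenue′ G σ p
      revenue-cong π σ π≈σ p = sum-cong-≗ λ i →
        ≡.cong (λ x → p i * (1# - p i) * (w i i + x)) (sum-cong-≗ λ j →
          ≡.cong₂ (λ a b → if does (a <? b) then p j * w j i else 0#) (π≈σ j) (π≈σ i))

      best : ∀ π → ∃ λ p → Box p × (∀ q → Box q → revenue′ G π q ≤ revenue′ G π p)
      best π = boxMaximum (revenue′ G π) (tame-revenue π)

      value : Permutation′ n → Carrier
      value π = revenue′ G π (proj₁ (best π))

      value-cong : ∀ π σ → π Perm.≈ σ → value π ≤ value σ
      value-cong π σ π≈σ = ≤-trans
        (≤-reflexive (reflexive (revenue-cong π σ π≈σ (proj₁ (best π)))))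
        (proj₂ (proj₂ (best σ)) _ (proj₁ (proj₂ (best π))))

    abstract
      maximumRevenue : ∃ (IsMaximum (R G))
      maximumRevenue = value (proj₁ top)
        , (strategy (proj₁ top) (proj₁ (best (proj₁ top))) (proj₁ (proj₂ (best (proj₁ top)))) , refl)
        , λ s → ≤-trans
            (proj₂ (proj₂ (best (Strategy.π s))) (Strategy.p s) (Strategy.valid s))
            (proj₂ top (Strategy.π s))
        where
        top : ∃ λ π → ∀ σ → value σ ≤ value π
        top = permMaximum value value-cong


module _ {ℝ : CompleteOrderedField} where
  open CompleteOrderedField ℝ
  open Revenue ℝ

  R-max : ∀ {n} → SocialNetwork ℝ n → Carrier
  R-max G = proj₁ (MaximumExists.maximumRevenue ℝ G)

  R-max-isMaximum : ∀ {n} (G : SocialNetwork ℝ n) → IsMaximum (R G) (R-max G)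
  R-max-isMaximum G = proj₂ (MaximumExists.maximumRevenue ℝ G)

module Submission where

-- Starting from an optimal strategy (π, p), put buyer i in A independently with probability
-- q i = max(0, 2.268 (p i) − 1.4155).  By linearity of expectation the expected revenue of
-- IE(A, p₀) is a combination of the weights, so it suffices to compare coefficients: loops
-- give an inequality in p i alone, and an edge j → i with j before i gives one in p j and
-- p i.  Some A does at least as well as the average.

open import Defs
open import Data.Fin.Subset using (Subset; ∁)
open import Data.Nat.Base as ℕ using (ℕ; zero; suc)
open import Data.Product.Base using (∃; _×_; _,_; proj₁; proj₂)

import Algebra.Properties.CommutativeMonoid.Sum as CommutativeMonoidSum
import Algebra.Properties.CommutativeSemigroup as CommutativeSemigroupProperties
import Algebra.Properties.Group as GroupProperties
import Algebra.Properties.Monoid.Mult as MonoidMult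
import Algebra.Properties.Ring as RingProperties
import Algebra.Properties.Semiring.Mult as SemiringMult
import Algebra.Properties.Semiring.Sum as SemiringSum
import Algebra.Solver.Ring as RingSolver
import Algebra.Solver.Ring.AlmostCommutativeRing as ACR
import Algebra.Solver.Ring.NaturalCoefficients.Default as SemiringSolver
open import Data.Bool.Base using (Bool; true; false; if_then_else_; not; _∧_)
open import Data.Fin.Base using (Fin; zero; suc)
open import Data.Fin.Permutation using (Permutation′; _⟨$⟩ʳ_; _⟨$⟩ˡ_; inverseˡ)
open import Data.Fin.Properties using (_≟_; _<?_; <-cmp)
open import Data.Fin.Subset.Properties using (_∈?_)
open import Data.Integer.Base as ℤ using (ℤ; +_; -[1+_]; _⊖_)
import Data.Integer.Properties as ℤ
open import Data.Maybe.Base using (Maybe; just; nothing)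
open import Data.Rational.Unnormalised.Base as ℚ using (ℚᵘ; mkℚᵘ; ↥_; ↧_; 0ℚᵘ; 1ℚᵘ; *≡*)
import Data.Rational.Unnormalised.Properties as ℚ
import Data.Sign.Base as Sign
open import Data.Sum.Base using (_⊎_; inj₁; inj₂)
open import Data.Vec.Base using ([]; _∷_; lookup)
open import Data.Vec.Properties using (lookup-map)
open import Function.Base using (_∘_)
open import Level using (0ℓ)
open import Relation.Binary.Bundles using (Poset)
open import Relation.Binary.Definitions using (tri<; tri≈; tri>)
open import Relation.Binary.PropositionalEquality.Core as ≡ using (_≡_; _≢_)
import Relation.Binary.Reasoning.PartialOrder as PosetReasoning
open import Relation.Binary.Structures using (IsDecTotalOrder)
open import Relation.Nullary using (¬_; yes; no; does; contradiction)
open import Relation.Nullary.Decidable using (dec-true; dec-false)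

-- Ordered-field arithmetic.

module OrderedField (ℝ : CompleteOrderedField) where
  open CompleteOrderedField ℝ public
  open IsDecTotalOrder isDecTotalOrder public
    using (total; antisym; isPartialOrder)
    renaming (refl to ≤-refl; trans to ≤-trans; reflexive to ≤-reflexive)
  open RingProperties ring using (-‿distribˡ-*; -‿distribʳ-*; x[y-z]≈xy-xz)
  open GroupProperties +-group using (⁻¹-involutive; ε⁻¹≈ε; ⁻¹-anti-homo-∙)
  open SemiringSolver commutativeSemiring using () renaming
    (solve to solveₙ; _:+_ to _:+ₙ_; _:*_ to _:*ₙ_; _:=_ to _:=ₙ_)

  ≤-poset : Poset 0ℓ 0ℓ 0ℓ
  ≤-poset = record { isPartialOrder = isPartialOrder }

  module ≤-Reasoning = PosetReasoning ≤-poset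
    using (begin_; step-≤; step-≈-⟩; step-≈-⟨; _∎)
  open ≤-Reasoning

  +-mono-≤ : ∀ {x y u v} → x ≤ y → u ≤ v → x + u ≤ y + v
  +-mono-≤ {x} {y} {u} {v} x≤y u≤v = begin
    x + u  ≤⟨ +-monoˡ-≤ u x≤y ⟩
    y + u  ≈⟨ +-comm y u ⟩
    u + y  ≤⟨ +-monoˡ-≤ y u≤v ⟩
    v + y  ≈⟨ +-comm v y ⟩
    y + v  ∎

  +-nonneg : ∀ {x y} → 0# ≤ x → 0# ≤ y → 0# ≤ x + y
  +-nonneg 0≤x 0≤y = ≤-trans (≤-reflexive (sym (+-identityˡ 0#))) (+-mono-≤ 0≤x 0≤y)

  x≤x+y : ∀ {x y} → 0# ≤ y → x ≤ x + y
  x≤x+y {x} 0≤y = ≤-trans (≤-reflexive (sym (+-identityʳ x))) (+-mono-≤ ≤-refl 0≤y)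

  x-y+y≈x : ∀ x y → x - y + y ≈ x
  x-y+y≈x x y = trans (+-assoc x (- y) y) (trans (+-congˡ (-‿inverseˡ y)) (+-identityʳ x))

  x-y≈0⇒x≈y : ∀ {x y} → x - y ≈ 0# → x ≈ y
  x-y≈0⇒x≈y {x} {y} h = trans (sym (x-y+y≈x x y)) (trans (+-congʳ h) (+-identityˡ y))

  x≤y⇒0≤y-x : ∀ {x y} → x ≤ y → 0# ≤ y - x
  x≤y⇒0≤y-x {x} {y} x≤y = ≤-trans (≤-reflexive (sym (-‿inverseʳ x))) (+-monoˡ-≤ (- x) x≤y)

  0≤y-x⇒x≤y : ∀ {x y} → 0# ≤ y - x → x ≤ y
  0≤y-x⇒x≤y {x} {y} 0≤y-x = begin
    x          ≈⟨ +-identityˡ x ⟨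
    0# + x     ≤⟨ +-monoˡ-≤ x 0≤y-x ⟩
    y - x + x  ≈⟨ x-y+y≈x y x ⟩
    y          ∎

  x≤0⇒0≤-x : ∀ {x} → x ≤ 0# → 0# ≤ - x
  x≤0⇒0≤-x {x} x≤0 = ≤-trans (x≤y⇒0≤y-x x≤0) (≤-reflexive (+-identityˡ (- x)))

  *-monoʳ-≤ : ∀ {z x y} → 0# ≤ z → x ≤ y → z * x ≤ z * y
  *-monoʳ-≤ {z} {x} {y} 0≤z x≤y = 0≤y-x⇒x≤y
    (≤-trans (*-nonneg 0≤z (x≤y⇒0≤y-x x≤y)) (≤-reflexive (x[y-z]≈xy-xz z y x)))

  x²-nonneg : ∀ x → 0# ≤ x * x
  x²-nonneg x with total 0# x
  ... | inj₁ 0≤x = *-nonneg 0≤x 0≤x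
  ... | inj₂ x≤0 = begin
    0#           ≤⟨ *-nonneg (x≤0⇒0≤-x x≤0) (x≤0⇒0≤-x x≤0) ⟩
    - x * - x    ≈⟨ -‿distribˡ-* x (- x) ⟨
    - (x * - x)  ≈⟨ -‿cong (-‿distribʳ-* x x) ⟨
    - - (x * x)  ≈⟨ ⁻¹-involutive (x * x) ⟩
    x * x        ∎

  0≤1 : 0# ≤ 1#
  0≤1 = ≤-trans (x²-nonneg 1#) (≤-reflexive (*-identityˡ 1#))

  open MonoidMult +-monoid using (×-homo-+)
  open SemiringMult semiring using (×1-homo-*)

  ×1-nonneg : ∀ n → 0# ≤ n ×ℕ 1#
  ×1-nonneg zero    = ≤-refl
  ×1-nonneg (suc n) = +-nonneg 0≤1 (×1-nonneg n)

  suc×1≉0 : ∀ n → ¬ suc n ×ℕ 1# ≈ 0#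
  suc×1≉0 n h = 0≉1 (antisym 0≤1 (≤-trans (x≤x+y (×1-nonneg n)) (≤-reflexive h)))

  -- The inverse equals `x` times its own square, a product of nonnegative factors.
  ⁻¹-nonneg : ∀ {x} → 0# ≤ x → ¬ x ≈ 0# → 0# ≤ x ⁻¹
  ⁻¹-nonneg {x} 0≤x x≉0 = begin
    0#                  ≤⟨ *-nonneg 0≤x (x²-nonneg (x ⁻¹)) ⟩
    x * (x ⁻¹ * x ⁻¹)   ≈⟨ *-assoc x _ _ ⟨
    x * x ⁻¹ * x ⁻¹     ≈⟨ *-congʳ (⁻¹-inverseʳ x x≉0) ⟩
    1# * x ⁻¹           ≈⟨ *-identityˡ _ ⟩
    x ⁻¹                ∎

  -- The embedding of the integers and the rationals.

  fromℤ : ℤ → Carrier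
  fromℤ (+ n)    = n ×ℕ 1#
  fromℤ -[1+ n ] = - (suc n ×ℕ 1#)

  fromℤ-⊖ : ∀ m n → fromℤ (m ⊖ n) ≈ m ×ℕ 1# - n ×ℕ 1#
  fromℤ-⊖ m       zero    = sym (trans (+-congˡ ε⁻¹≈ε) (+-identityʳ _))
  fromℤ-⊖ zero    (suc n) = sym (+-identityˡ _)
  fromℤ-⊖ (suc m) (suc n) = trans (reflexive (≡.cong fromℤ (ℤ.[1+m]⊖[1+n]≡m⊖n m n)))
    (trans (fromℤ-⊖ m n) (sym
    (trans (+-congˡ (⁻¹-anti-homo-∙ 1# (n ×ℕ 1#)))
    (trans (solveₙ 4 (λ o a o⁻ b → (o :+ₙ a) :+ₙ (b :+ₙ o⁻) :=ₙ (a :+ₙ b) :+ₙ (o :+ₙ o⁻)) refl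
             1# (m ×ℕ 1#) (- 1#) (- (n ×ℕ 1#)))
    (trans (+-congˡ (-‿inverseʳ 1#)) (+-identityʳ _))))))

  fromℤ-homo-+ : ∀ i j → fromℤ (i ℤ.+ j) ≈ fromℤ i + fromℤ j
  fromℤ-homo-+ (+ m)    (+ n)    = ×-homo-+ 1# m n
  fromℤ-homo-+ (+ m)    -[1+ n ] = fromℤ-⊖ m (suc n)
  fromℤ-homo-+ -[1+ m ] (+ n)    = trans (fromℤ-⊖ n (suc m)) (+-comm _ _)
  fromℤ-homo-+ -[1+ m ] -[1+ n ] = trans
    (-‿cong (trans (+-congˡ (×-homo-+ 1# (suc m) n))
      (solveₙ 3 (λ o a b → o :+ₙ (a :+ₙ b) :=ₙ (o :+ₙ b) :+ₙ a) refl 1# (suc m ×ℕ 1#) (n ×ℕ 1#))))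
    (⁻¹-anti-homo-∙ _ _)

  fromℤ-homo-neg : ∀ i → fromℤ (ℤ.- i) ≈ - fromℤ i
  fromℤ-homo-neg (+ zero)  = sym ε⁻¹≈ε
  fromℤ-homo-neg (+ suc n) = refl
  fromℤ-homo-neg -[1+ n ]  = sym (⁻¹-involutive _)

  fromℤ-◃- : ∀ n → fromℤ (Sign.- ℤ.◃ n) ≈ - (n ×ℕ 1#)
  fromℤ-◃- n = trans (reflexive (≡.cong fromℤ (ℤ.-◃n≡-n n))) (fromℤ-homo-neg (+ n))

  fromℤ-homo-* : ∀ i j → fromℤ (i ℤ.* j) ≈ fromℤ i * fromℤ j
  fromℤ-homo-* (+ m)    (+ n)    =
    trans (reflexive (≡.cong fromℤ (ℤ.+◃n≡+n (m ℕ.* n)))) (×1-homo-* m n)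
  fromℤ-homo-* (+ m)    -[1+ n ] = trans (fromℤ-◃- (m ℕ.* suc n))
    (trans (-‿cong (×1-homo-* m (suc n))) (-‿distribʳ-* _ _))
  fromℤ-homo-* -[1+ m ] (+ n)    = trans (fromℤ-◃- (suc m ℕ.* n))
    (trans (-‿cong (×1-homo-* (suc m) n)) (-‿distribˡ-* _ _))
  fromℤ-homo-* -[1+ m ] -[1+ n ] = trans (×1-homo-* (suc m) (suc n))
    (sym (trans (sym (-‿distribˡ-* _ _))
      (trans (-‿cong (sym (-‿distribʳ-* _ _))) (⁻¹-involutive _))))

  -- Opaque, so that the type checker never unfolds large numerals into unary sums.
  opaque
    ⟦_⟧ : ℚᵘ → Carrier
    ⟦ q ⟧ = fromℤ (↥ q) * fromℤ (↧ q) ⁻¹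

    -- Definitional only where `⟦_⟧` unfolds; it carries the fractions of the theorem statement over
    -- to the opaque form.
    /≡⟦⟧ : ∀ m d → m / suc d ≡ ⟦ mkℚᵘ (+ m) d ⟧
    /≡⟦⟧ m d = ≡.refl

    -- For a closed fraction the instance is found by evaluating the sign of the numerator, so the
    -- numerical checks on the constants below all take place here.
    ⟦⟧-nonneg : ∀ q → .{{ℚ.NonNegative q}} → 0# ≤ ⟦ q ⟧
    ⟦⟧-nonneg (mkℚᵘ (+ n) d) =
      *-nonneg (×1-nonneg n) (⁻¹-nonneg (×1-nonneg (suc d)) (suc×1≉0 d))

    ⟦⟧-*-↧ : ∀ q → ⟦ q ⟧ * fromℤ (↧ q) ≈ fromℤ (↥ q)
    ⟦⟧-*-↧ q = trans (*-assoc _ _ _)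
      (trans (*-congˡ (trans (*-comm _ _) (⁻¹-inverseʳ _ (suc×1≉0 (ℚᵘ.denominator-1 q)))))
        (*-identityʳ _))

    -- Reduces each homomorphism law to an equation with the denominators cleared.
    ⟦⟧-unique : ∀ {x} q → x * fromℤ (↧ q) ≈ fromℤ (↥ q) → ⟦ q ⟧ ≈ x
    ⟦⟧-unique {x} q h = trans (*-congʳ (sym h)) (trans (*-assoc _ _ _)
      (trans (*-congˡ (⁻¹-inverseʳ _ (suc×1≉0 (ℚᵘ.denominator-1 q)))) (*-identityʳ x)))

  ⟦⟧-homo-+ : ∀ p q → ⟦ p ℚ.+ q ⟧ ≈ ⟦ p ⟧ + ⟦ q ⟧
  ⟦⟧-homo-+ p@(mkℚᵘ m d) q@(mkℚᵘ n e) = ⟦⟧-unique (p ℚ.+ q) (trans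
    (*-congˡ (fromℤ-homo-* (+ suc d) (+ suc e)))
    (trans (solveₙ 4 (λ x y u v → (x :+ₙ y) :*ₙ (u :*ₙ v) :=ₙ (x :*ₙ u) :*ₙ v :+ₙ (y :*ₙ v) :*ₙ u) refl
             ⟦ p ⟧ ⟦ q ⟧ (fromℤ (↧ p)) (fromℤ (↧ q)))
    (trans (+-cong (*-congʳ (⟦⟧-*-↧ p)) (*-congʳ (⟦⟧-*-↧ q)))
    (sym (trans (fromℤ-homo-+ (m ℤ.* ↧ q) (n ℤ.* ↧ p))
      (+-cong (fromℤ-homo-* m (↧ q)) (fromℤ-homo-* n (↧ p))))))))

  ⟦⟧-homo-* : ∀ p q → ⟦ p ℚ.* q ⟧ ≈ ⟦ p ⟧ * ⟦ q ⟧
  ⟦⟧-homo-* p@(mkℚᵘ m d) q@(mkℚᵘ n e) = ⟦⟧-unique (p ℚ.* q) (trans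
    (*-congˡ (fromℤ-homo-* (+ suc d) (+ suc e)))
    (trans (solveₙ 4 (λ x y u v → (x :*ₙ y) :*ₙ (u :*ₙ v) :=ₙ (x :*ₙ u) :*ₙ (y :*ₙ v)) refl
             ⟦ p ⟧ ⟦ q ⟧ (fromℤ (↧ p)) (fromℤ (↧ q)))
    (trans (*-cong (⟦⟧-*-↧ p) (⟦⟧-*-↧ q)) (sym (fromℤ-homo-* m n)))))

  ⟦⟧-homo-neg : ∀ p → ⟦ ℚ.- p ⟧ ≈ - ⟦ p ⟧
  ⟦⟧-homo-neg p@(mkℚᵘ m d) = ⟦⟧-unique (ℚ.- p) (trans (sym (-‿distribˡ-* _ _))
    (trans (-‿cong (⟦⟧-*-↧ p)) (sym (fromℤ-homo-neg m))))

  ⟦0⟧≈0 : ⟦ 0ℚᵘ ⟧ ≈ 0#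
  ⟦0⟧≈0 = ⟦⟧-unique 0ℚᵘ (zeroˡ _)

  ⟦1⟧≈1 : ⟦ 1ℚᵘ ⟧ ≈ 1#
  ⟦1⟧≈1 = ⟦⟧-unique 1ℚᵘ (*-identityˡ _)

  -- Passing to `p - q` turns the cross-multiplied equality into a numerator that is literally 0,
  -- whatever the denominator.
  ⟦⟧-cong : ∀ {p q} → p ℚ.≃ q → ⟦ p ⟧ ≈ ⟦ q ⟧
  ⟦⟧-cong {p} {q} p≃q = x-y≈0⇒x≈y (trans (+-congˡ (sym (⟦⟧-homo-neg q)))
    (trans (sym (⟦⟧-homo-+ p (ℚ.- q))) (⟦⟧-unique (p ℚ.- q)
      (trans (zeroˡ _) (reflexive (≡.cong fromℤ (≡.sym (numerator≡0 (ℚ.p≃q⇒p-q≃0 p q p≃q)))))))))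
    where
    numerator≡0 : ∀ {r} → r ℚ.≃ 0ℚᵘ → ↥ r ≡ + 0
    numerator≡0 {r} (*≡* h) = ≡.trans (≡.sym (ℤ.*-identityʳ (↥ r))) h

  almostCommutativeRing : ACR.AlmostCommutativeRing 0ℓ 0ℓ
  almostCommutativeRing = ACR.fromCommutativeRing commutativeRing

  ⟦⟧-morphism : ℚ.+-*-rawRing ACR.-Raw-AlmostCommutative⟶ almostCommutativeRing
  ⟦⟧-morphism = record
    { ⟦_⟧    = ⟦_⟧
    ; +-homo = ⟦⟧-homo-+
    ; *-homo = ⟦⟧-homo-*
    ; -‿homo = ⟦⟧-homo-neg
    ; 0-homo = ⟦0⟧≈0
    ; 1-homo = ⟦1⟧≈1
    }

  ⟦⟧-≟ : ∀ p q → Maybe (⟦ p ⟧ ≈ ⟦ q ⟧)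
  ⟦⟧-≟ p q with p ℚ.≃? q
  ... | yes p≃q = just (⟦⟧-cong p≃q)
  ... | no  _   = nothing

  -- Coefficients are unnormalised fractions, so only a polynomial that normalises to zero is
  -- recognised reliably: identities are solved in the form x - y := con 0ℚᵘ.
  open RingSolver ℚ.+-*-rawRing almostCommutativeRing ⟦⟧-morphism ⟦⟧-≟ public
    using (Polynomial; con; _:+_; _:*_; _:-_; _:^_; :-_; solve; _:=_)

  ≈-certificate : ∀ {x y} → x - y ≈ ⟦ 0ℚᵘ ⟧ → x ≈ y
  ≈-certificate h = x-y≈0⇒x≈y (trans h ⟦0⟧≈0)

  -- Here `z` is an explicit slack: the solver checks the identity, and the nonnegativity of `z` is
  -- assembled by hand.
  ≤-certificate : ∀ {x y z} → y - (x + z) ≈ ⟦ 0ℚᵘ ⟧ → 0# ≤ z → x ≤ y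
  ≤-certificate {x} {y} {z} h 0≤z =
    ≤-trans (x≤x+y 0≤z) (≤-reflexive (sym (≈-certificate h)))

-- Polynomial inequalities between prices and influence probabilities.

module InfluenceProbability (ℝ : CompleteOrderedField) where
  open OrderedField ℝ

  -- slope and offset are γ / (4 κ (1 − p₀)) and p₀ / (1 − p₀), rounded up: the exact values
  -- make lower-bound an equality for a = ℓ x.  ρ = 1 − ℓ 1.
  γ p₀ κ γ/4 slope offset ρ : ℚᵘ
  γ      = + 9111 ℚ./ 10000
  p₀     = + 586 ℚ./ 1000
  κ      = p₀ ℚ.* (1ℚᵘ ℚ.- p₀)
  γ/4    = γ ℚ.* (+ 1 ℚ./ 4)
  slope  = + 22680 ℚ./ 10000
  offset = + 14155 ℚ./ 10000
  ρ      = + 1475 ℚ./ 10000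

  κ≈p₀[1-p₀] : ⟦ κ ⟧ ≈ ⟦ p₀ ⟧ * (1# - ⟦ p₀ ⟧)
  κ≈p₀[1-p₀] = trans (⟦⟧-homo-* p₀ (1ℚᵘ ℚ.- p₀))
    (*-congˡ (trans (⟦⟧-homo-+ 1ℚᵘ (ℚ.- p₀)) (+-cong ⟦1⟧≈1 (⟦⟧-homo-neg p₀))))

  ℓ : Carrier → Carrier
  ℓ x = ⟦ slope ⟧ * x - ⟦ offset ⟧

  -- a = max(0, ℓ x), the probability that a buyer of price x joins the influence set.
  record Influence (x a : Carrier) : Set where
    field
      nonneg : 0# ≤ a
      lower  : ℓ x ≤ a
      upper  : a ≤ 0# ⊎ a ≤ ℓ x

  influence : ∀ x → ∃ (Influence x)
  influence x with total 0# (ℓ x)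
  ... | inj₁ 0≤ℓ = ℓ x , record { nonneg = 0≤ℓ    ; lower = ≤-refl ; upper = inj₂ ≤-refl }
  ... | inj₂ ℓ≤0 = 0#  , record { nonneg = ≤-refl ; lower = ℓ≤0    ; upper = inj₁ ≤-refl }

  private
    variable
      n : ℕ

    -- The zeroth power evaluates definitionally to 1#, unlike con 1ℚᵘ.
    :1 : Polynomial (suc n)
    :1 = con 1ℚᵘ :^ 0

    :ℓ : Polynomial n → Polynomial n
    :ℓ x = con slope :* x :- con offset

    -- The minimum point of − t (ℓ x) − γ x (1 − x) as a function of x.
    vertex : ℚᵘ → ℚᵘ
    vertex t = (γ ℚ.+ t ℚ.* slope) ℚ.÷ (γ ℚ.+ γ)

  module _ {x a : Carrier} (½≤x : ⟦ ℚ.½ ⟧ ≤ x) (x≤1 : x ≤ 1#) (I : Influence x a) where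
    open Influence I

    -- This is the edge inequality for a later buyer of price 1/2 with `b = 0`. The right side
    -- increases with `a`, so `a` may be lowered to `ℓ x`; what remains is linear in `x`, with slope
    -- `α` and value `β` at `x = 1/2`.
    lower-bound : ⟦ γ/4 ⟧ * x ≤ ⟦ κ ⟧ * (a + ⟦ p₀ ⟧ * (1# - a))
    lower-bound = ≤-certificate
      (solve 2 (λ x a → con κ :* (a :+ con p₀ :* (:1 :- a))
          :- (con γ/4 :* x :+ (con (κ ℚ.* q₀) :* (a :- :ℓ x)
              :+ (con α :* (x :- con ℚ.½) :+ con β)))
          := con 0ℚᵘ) refl x a)
      (+-nonneg (*-nonneg (⟦⟧-nonneg (κ ℚ.* q₀)) (x≤y⇒0≤y-x lower))
        (+-nonneg (*-nonneg (⟦⟧-nonneg α) (x≤y⇒0≤y-x ½≤x)) (⟦⟧-nonneg β)))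
      where
      q₀ α β : ℚᵘ
      q₀ = 1ℚᵘ ℚ.- p₀
      α  = κ ℚ.* q₀ ℚ.* slope ℚ.- γ/4
      β  = κ ℚ.* p₀ ℚ.- κ ℚ.* q₀ ℚ.* offset ℚ.+ α ℚ.* ℚ.½

    -- In the second case `ℓ` is increasing and `x ≤ 1`, so `a ≤ ℓ 1`.
    ρ≤1-a : ⟦ ρ ⟧ ≤ 1# - a
    ρ≤1-a with upper
    ... | inj₁ a≤0 = ≤-certificate
      (solve 1 (λ a → (:1 :- a) :- (con ρ :+ (con (1ℚᵘ ℚ.- ρ) :+ :- a)) := con 0ℚᵘ) refl a)
      (+-nonneg (⟦⟧-nonneg (1ℚᵘ ℚ.- ρ)) (x≤0⇒0≤-x a≤0))
    ... | inj₂ a≤ℓ = ≤-certificate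
      (solve 2 (λ x a → (:1 :- a) :- (con ρ :+ (con slope :* (:1 :- x) :+ (:ℓ x :- a)))
          := con 0ℚᵘ) refl x a)
      (+-nonneg (*-nonneg (⟦⟧-nonneg slope) (x≤y⇒0≤y-x x≤1)) (x≤y⇒0≤y-x a≤ℓ))

    -- If `a ≤ 0`, completing the square bounds `x (1 - x)` by 1/4, and `γ/4 ≤ κ`. Otherwise raising
    -- `a` to `ℓ x` only shrinks the right side, and the difference becomes a quadratic in `x` with
    -- leading coefficient `γ`.
    loop-bound : ⟦ γ ⟧ * (x * (1# - x)) ≤ ⟦ κ ⟧ * (1# - a)
    loop-bound with upper
    ... | inj₁ a≤0 = ≤-certificate
      (solve 2 (λ x a → con κ :* (:1 :- a) :- (con γ :* (x :* (:1 :- x))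
          :+ (con γ :* ((x :- con ℚ.½) :* (x :- con ℚ.½)) :+ (con (κ ℚ.- γ/4) :+ con κ :* (:- a))))
          := con 0ℚᵘ) refl x a)
      (+-nonneg (*-nonneg (⟦⟧-nonneg γ) (x²-nonneg _))
        (+-nonneg (⟦⟧-nonneg (κ ℚ.- γ/4)) (*-nonneg (⟦⟧-nonneg κ) (x≤0⇒0≤-x a≤0))))
    ... | inj₂ a≤ℓ = ≤-certificate
      (solve 2 (λ x a → con κ :* (:1 :- a) :- (con γ :* (x :* (:1 :- x))
          :+ (con γ :* ((x :- con v) :* (x :- con v)) :+ (con δ :+ con κ :* (:ℓ x :- a))))
          := con 0ℚᵘ) refl x a)
      (+-nonneg (*-nonneg (⟦⟧-nonneg γ) (x²-nonneg _))
        (+-nonneg (⟦⟧-nonneg δ) (*-nonneg (⟦⟧-nonneg κ) (x≤y⇒0≤y-x a≤ℓ))))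
      where
      -- `v` is where that quadratic is least and `δ` is its minimum, about 0.00005, so this case is
      -- nearly tight.
      v δ : ℚᵘ
      v = vertex κ
      δ = κ ℚ.+ κ ℚ.* offset ℚ.- γ ℚ.* (v ℚ.* v)

    -- Applied to the later buyer of an edge. If that buyer is in the influence set, the earlier one
    -- still stays outside with probability at least `ρ`, whence `κ ρ`. The right side is
    -- `γ/4 - τ a`, decreasing in `a`, so the two cases go as in `loop-bound` with `τ` as the
    -- coefficient of `a`.
    successor-bound : ⟦ γ ⟧ * (x * (1# - x)) ≤ ⟦ κ ℚ.* ρ ⟧ * a + ⟦ γ/4 ⟧ * (1# - a)
    successor-bound with upper
    ... | inj₁ a≤0 = ≤-certificate
      (solve 2 (λ x a → (con (κ ℚ.* ρ) :* a :+ con γ/4 :* (:1 :- a)) :- (con γ :* (x :* (:1 :- x))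
          :+ (con γ :* ((x :- con ℚ.½) :* (x :- con ℚ.½)) :+ con τ :* (:- a)))
          := con 0ℚᵘ) refl x a)
      (+-nonneg (*-nonneg (⟦⟧-nonneg γ) (x²-nonneg _)) (*-nonneg (⟦⟧-nonneg τ) (x≤0⇒0≤-x a≤0)))
      where
      τ : ℚᵘ
      τ = γ/4 ℚ.- κ ℚ.* ρ
    ... | inj₂ a≤ℓ = ≤-certificate
      (solve 2 (λ x a → (con (κ ℚ.* ρ) :* a :+ con γ/4 :* (:1 :- a)) :- (con γ :* (x :* (:1 :- x))
          :+ (con γ :* ((x :- con v) :* (x :- con v)) :+ (con δ :+ con τ :* (:ℓ x :- a))))
          := con 0ℚᵘ) refl x a)
      (+-nonneg (*-nonneg (⟦⟧-nonneg γ) (x²-nonneg _))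
        (+-nonneg (⟦⟧-nonneg δ) (*-nonneg (⟦⟧-nonneg τ) (x≤y⇒0≤y-x a≤ℓ))))
      where
      τ v δ : ℚᵘ
      τ = γ/4 ℚ.- κ ℚ.* ρ
      v = vertex τ
      δ = γ/4 ℚ.+ τ ℚ.* offset ℚ.- γ ℚ.* (v ℚ.* v)

  -- The influence, per unit weight, of a buyer in A with probability b on one in A with
  -- probability a; the factor 1 / 2 is the chance to come first if neither is in A.
  pairRevenue : Carrier → Carrier → Carrier
  pairRevenue a b = (1# - a) * (b + (1# - b) * (⟦ p₀ ⟧ * ⟦ ℚ.½ ⟧))

  -- The slack is x · successor-bound + (1 − x) κ ρ b + (1 − b) · lower-bound + κ b (1 − a − ρ).
  edge-bound : ∀ {x y a b} → ⟦ ℚ.½ ⟧ ≤ x → x ≤ 1# → Influence x a →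
    ⟦ ℚ.½ ⟧ ≤ y → y ≤ 1# → Influence y b →
    ⟦ γ ⟧ * (y * (1# - y) * x) ≤ ⟦ κ ⟧ * (pairRevenue b a + pairRevenue a b)
  edge-bound {x} {y} {a} {b} ½≤x x≤1 I ½≤y y≤1 J = ≤-certificate
    (solve 4 (λ x y a b →
        con κ :* (:pair b a :+ :pair a b) :- (con γ :* (y :* (:1 :- y) :* x) :+ (
          x :* ((con (κ ℚ.* ρ) :* b :+ con γ/4 :* (:1 :- b)) :- con γ :* (y :* (:1 :- y)))
          :+ ((:1 :- x) :* (con (κ ℚ.* ρ) :* b)
          :+ ((:1 :- b) :* (con κ :* (a :+ con p₀ :* (:1 :- a)) :- con γ/4 :* x)
          :+ con κ :* (b :* ((:1 :- a) :- con ρ))))))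
        := con 0ℚᵘ) refl x y a b)
    (+-nonneg (*-nonneg 0≤x (x≤y⇒0≤y-x (successor-bound ½≤y y≤1 J)))
    (+-nonneg (*-nonneg (x≤y⇒0≤y-x x≤1) (*-nonneg (⟦⟧-nonneg (κ ℚ.* ρ)) (Influence.nonneg J)))
    (+-nonneg (*-nonneg 0≤1-b (x≤y⇒0≤y-x (lower-bound ½≤x x≤1 I)))
      (*-nonneg (⟦⟧-nonneg κ) (*-nonneg (Influence.nonneg J) (x≤y⇒0≤y-x (ρ≤1-a ½≤x x≤1 I)))))))
    where
    :pair : Polynomial (suc n) → Polynomial (suc n) → Polynomial (suc n)
    :pair a b = (:1 :- a) :* (b :+ (:1 :- b) :* (con p₀ :* con ℚ.½))
    0≤x : 0# ≤ x
    0≤x = ≤-trans (⟦⟧-nonneg ℚ.½) ½≤x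
    0≤1-b : 0# ≤ 1# - b
    0≤1-b = ≤-trans (⟦⟧-nonneg ρ) (ρ≤1-a ½≤y y≤1 J)

-- Expectation over random subsets with independent membership.

module Expectation (ℝ : CompleteOrderedField) where
  open OrderedField ℝ
  open ≤-Reasoning
  open CommutativeMonoidSum +-commutativeMonoid public
    using (sum-cong-≋; ∑-distrib-+; ∑-comm; sum-replicate-zero)
  open SemiringSum semiring public using (*-distribˡ-sum)

  sum-mono : ∀ {n} {f g : Fin n → Carrier} → (∀ i → f i ≤ g i) → sum f ≤ sum g
  sum-mono {zero}  f≤g = ≤-refl
  sum-mono {suc n} f≤g = +-mono-≤ (f≤g zero) (sum-mono (f≤g ∘ suc))

  mix : Carrier → (Bool → Carrier) → Carrier
  mix q f = (1# - q) * f false + q * f true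

  mix-cong : ∀ q {f g} → (∀ b → f b ≈ g b) → mix q f ≈ mix q g
  mix-cong q f≈g = +-cong (*-congˡ (f≈g false)) (*-congˡ (f≈g true))

  mix-const : ∀ q x → mix q (λ _ → x) ≈ x
  mix-const q x = ≈-certificate
    (solve 2 (λ q x → (con 1ℚᵘ :^ 0 :- q) :* x :+ q :* x :- x := con 0ℚᵘ) refl q x)

  mix-+ : ∀ q f g → mix q (λ b → f b + g b) ≈ mix q f + mix q g
  mix-+ q f g = ≈-certificate
    (solve 5 (λ q f₀ f₁ g₀ g₁ → ((con 1ℚᵘ :^ 0 :- q) :* (f₀ :+ g₀) :+ q :* (f₁ :+ g₁))
      :- (((con 1ℚᵘ :^ 0 :- q) :* f₀ :+ q :* f₁) :+ ((con 1ℚᵘ :^ 0 :- q) :* g₀ :+ q :* g₁)) := con 0ℚᵘ)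
      refl q (f false) (f true) (g false) (g true))

  mix-* : ∀ q x f → mix q (λ b → x * f b) ≈ x * mix q f
  mix-* q x f = ≈-certificate
    (solve 4 (λ q x f₀ f₁ → ((con 1ℚᵘ :^ 0 :- q) :* (x :* f₀) :+ q :* (x :* f₁))
      :- x :* ((con 1ℚᵘ :^ 0 :- q) :* f₀ :+ q :* f₁) := con 0ℚᵘ)
      refl q x (f false) (f true))

  mix-comm : ∀ q r (g : Bool → Bool → Carrier) →
             mix r (λ c → mix q (λ b → g b c)) ≈ mix q (λ b → mix r (g b))
  mix-comm q r g = trans (mix-+ r (λ c → (1# - q) * g false c) (λ c → q * g true c))
    (+-cong (mix-* r (1# - q) (g false)) (mix-* r q (g true)))

  -- A weighted mean of two values is at most the larger one.
  mix-max : ∀ {q} f → 0# ≤ q → q ≤ 1# → ∃ λ b → mix q f ≤ f b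
  mix-max {q} f 0≤q q≤1 with total (f false) (f true)
  ... | inj₁ h = true , ≤-trans (+-mono-≤ (*-monoʳ-≤ (x≤y⇒0≤y-x q≤1) h) ≤-refl)
                          (≤-reflexive (mix-const q (f true)))
  ... | inj₂ h = false , ≤-trans (+-mono-≤ ≤-refl (*-monoʳ-≤ 0≤q h))
                          (≤-reflexive (mix-const q (f false)))

  -- One coin per index, tossed in order along the vector. The recursion replaces a sum over all
  -- subsets weighted by products, so each law below is an induction over the corresponding law of
  -- `mix`.
  𝔼 : ∀ {n} → (Fin n → Carrier) → (Subset n → Carrier) → Carrier
  𝔼 {zero}  q f = f []
  𝔼 {suc n} q f = mix (q zero) λ b → 𝔼 (q ∘ suc) (f ∘ (b ∷_))

  𝔼-cong : ∀ {n} (q : Fin n → Carrier) {f g} → (∀ A → f A ≈ g A) → 𝔼 q f ≈ 𝔼 q g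
  𝔼-cong {zero}  q f≈g = f≈g []
  𝔼-cong {suc n} q f≈g = mix-cong (q zero) λ b → 𝔼-cong (q ∘ suc) (f≈g ∘ (b ∷_))

  𝔼-const : ∀ {n} (q : Fin n → Carrier) x → 𝔼 q (λ _ → x) ≈ x
  𝔼-const {zero}  q x = refl
  𝔼-const {suc n} q x = trans (mix-cong (q zero) λ _ → 𝔼-const (q ∘ suc) x) (mix-const (q zero) x)

  𝔼-+ : ∀ {n} (q : Fin n → Carrier) f g → 𝔼 q (λ A → f A + g A) ≈ 𝔼 q f + 𝔼 q g
  𝔼-+ {zero}  q f g = refl
  𝔼-+ {suc n} q f g = trans
    (mix-cong (q zero) λ b → 𝔼-+ (q ∘ suc) (f ∘ (b ∷_)) (g ∘ (b ∷_)))
    (mix-+ (q zero) (λ b → 𝔼 (q ∘ suc) (f ∘ (b ∷_))) (λ b → 𝔼 (q ∘ suc) (g ∘ (b ∷_))))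

  𝔼-* : ∀ {n} (q : Fin n → Carrier) x f → 𝔼 q (λ A → x * f A) ≈ x * 𝔼 q f
  𝔼-* {zero}  q x f = refl
  𝔼-* {suc n} q x f = trans
    (mix-cong (q zero) λ b → 𝔼-* (q ∘ suc) x (f ∘ (b ∷_)))
    (mix-* (q zero) x λ b → 𝔼 (q ∘ suc) (f ∘ (b ∷_)))

  𝔼-sum : ∀ {n} (q : Fin n → Carrier) m (f : Fin m → Subset n → Carrier) →
          𝔼 q (λ A → sum λ i → f i A) ≈ sum λ i → 𝔼 q (f i)
  𝔼-sum q zero    f = 𝔼-const q 0#
  𝔼-sum q (suc m) f = trans (𝔼-+ q (f zero) _) (+-congˡ (𝔼-sum q m (f ∘ suc)))

  𝔼-lookup : ∀ {n} (q : Fin n → Carrier) g i → 𝔼 q (λ A → g (lookup A i)) ≈ mix (q i) g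
  𝔼-lookup q g zero    = mix-cong (q zero) λ b → 𝔼-const (q ∘ suc) (g b)
  𝔼-lookup q g (suc i) = trans (mix-cong (q zero) λ _ → 𝔼-lookup (q ∘ suc) g i) (mix-const (q zero) _)

  -- Independence of two distinct coordinates: every other coin averages out by `mix-const`.
  𝔼-lookup₂ : ∀ {n} (q : Fin n → Carrier) (g : Bool → Bool → Carrier) {i j} → i ≢ j →
              𝔼 q (λ A → g (lookup A i) (lookup A j)) ≈ mix (q i) (λ b → mix (q j) (g b))
  𝔼-lookup₂ q g {zero}  {zero}  i≢j = contradiction ≡.refl i≢j
  𝔼-lookup₂ q g {zero}  {suc j} i≢j = mix-cong (q zero) λ b → 𝔼-lookup (q ∘ suc) (g b) j
  -- The coin of `j` is tossed first here, so the two averages appear in the wrong order and must be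
  -- exchanged.
  𝔼-lookup₂ q g {suc i} {zero}  i≢j = trans
    (mix-cong (q zero) λ c → 𝔼-lookup (q ∘ suc) (λ b → g b c) i) (mix-comm (q (suc i)) (q zero) g)
  𝔼-lookup₂ q g {suc i} {suc j} i≢j = trans
    (mix-cong (q zero) λ _ → 𝔼-lookup₂ (q ∘ suc) g (i≢j ∘ ≡.cong suc)) (mix-const (q zero) _)

  -- The method of conditional expectations: each coin in turn is fixed to the side with the larger
  -- conditional expectation.
  𝔼-attained : ∀ {n} (q : Fin n → Carrier) f → (∀ i → 0# ≤ q i) → (∀ i → q i ≤ 1#) →
               ∃ λ A → 𝔼 q f ≤ f A
  𝔼-attained {zero}  q f 0≤q q≤1 = [] , ≤-refl
  𝔼-attained {suc n} q f 0≤q q≤1 =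
    let b , h = mix-max (λ b → 𝔼 (q ∘ suc) (f ∘ (b ∷_))) (0≤q zero) (q≤1 zero)
        A , k = 𝔼-attained (q ∘ suc) (f ∘ (b ∷_)) (0≤q ∘ suc) (q≤1 ∘ suc)
    in b ∷ A , ≤-trans h k

-- Expected revenue of a random influence set.

does-∈? : ∀ {n} (i : Fin n) A → does (i ∈? A) ≡ lookup A i
does-∈? zero    (true  ∷ A) = ≡.refl
does-∈? zero    (false ∷ A) = ≡.refl
does-∈? (suc i) (_     ∷ A) = does-∈? i A

does-∈?-∁ : ∀ {n} (i : Fin n) A → does (i ∈? ∁ A) ≡ not (lookup A i)
does-∈?-∁ i A = ≡.trans (does-∈? i (∁ A)) (lookup-map i not A)

module _ (ℝ : CompleteOrderedField) where
  open OrderedField ℝ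
  open InfluenceProbability ℝ
  open Expectation ℝ
  open Revenue ℝ
  open CommutativeSemigroupProperties *-commutativeSemigroup using (x∙yz≈y∙xz)
  open ≤-Reasoning

  module _ {n : ℕ} (G : SocialNetwork ℝ n) where
    open SocialNetwork G

    unless : Bool → Carrier → Carrier
    unless b x = if b then 0# else x

    -- Influence per unit weight on a buyer with membership `b` from another with membership `c`;
    -- its expectation is `pairRevenue`.
    share : Bool → Bool → Carrier
    share b c = unless b (if c then 1# else ⟦ p₀ ⟧ * ⟦ ℚ.½ ⟧)

    x*0+∑0≈0 : ∀ x m (f : Fin m → Carrier) → (∀ j → f j ≈ 0#) → x * 0# + sum f ≈ 0#
    x*0+∑0≈0 x m f f≈0 = trans (+-cong (zeroʳ x) (trans (sum-cong-≋ f≈0) (sum-replicate-zero m)))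
                           (+-identityʳ 0#)

    -- Merges the sums over the influence set and its complement into one sum over `j` other than
    -- `i`. Each summand then depends on at most two memberships, as `𝔼-lookup` and `𝔼-lookup₂`
    -- require.
    IE-term : ∀ A i →
      (if does (i ∈? ∁ A) then
         w i i + ∑-over (_∈? A) (λ j → w j i)
         + sum (λ j → if does (j ∈? ∁ A) ∧ not (does (j ≟ i)) then ⟦ p₀ ⟧ * w j i * (1 / 2) else 0#)
       else 0#)
      ≈ w i i * unless (lookup A i) 1#
        + sum λ j → unless (does (j ≟ i)) (w j i * share (lookup A i) (lookup A j))
    IE-term A i rewrite does-∈?-∁ i A | /≡⟦⟧ 1 1 with lookup A i in i∈A
    ... | true  = sym (x*0+∑0≈0 _ n _ λ j → case j)
      where
      case : ∀ j → unless (does (j ≟ i)) (w j i * 0#) ≈ 0#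
      case j with does (j ≟ i)
      ... | true  = refl
      ... | false = zeroʳ _
    ... | false = trans (+-assoc _ _ _) (+-cong (sym (*-identityʳ _))
      (trans (sym (∑-distrib-+ {n} _ _)) (sum-cong-≋ case)))
      where
      case : ∀ j →
        (if does (j ∈? A) then w j i else 0#)
        + (if does (j ∈? ∁ A) ∧ not (does (j ≟ i)) then ⟦ p₀ ⟧ * w j i * ⟦ ℚ.½ ⟧ else 0#)
        ≈ unless (does (j ≟ i)) (w j i * share false (lookup A j))
      case j rewrite does-∈? j A | does-∈?-∁ j A with lookup A j in j∈A | j ≟ i
      ... | false | yes _ = +-identityʳ 0#
      ... | true  | no  _ = trans (+-identityʳ _) (sym (*-identityʳ _))
      ... | false | no  _ = trans (+-identityˡ _)
                              (trans (*-congʳ (*-comm _ _)) (*-assoc _ _ _))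
      -- The sum over `A` does not exclude `j = i` explicitly, but `i` is outside `A` in this
      -- branch.
      ... | true  | yes ≡.refl with () ← ≡.trans (≡.sym j∈A) i∈A

    precedes : Permutation′ n → Fin n → Fin n → Bool
    precedes π j i = does ((π ⟨$⟩ʳ j) <? (π ⟨$⟩ʳ i))

    -- Of two distinct buyers exactly one comes first; a buyer never precedes itself.
    split-by-order : ∀ π i j x → unless (does (j ≟ i)) x ≈
              (if precedes π j i then x else 0#) + (if precedes π i j then x else 0#)
    split-by-order π i j x with <-cmp (π ⟨$⟩ʳ j) (π ⟨$⟩ʳ i)
    ... | tri< lt ne gt
      rewrite dec-false (j ≟ i) (ne ∘ ≡.cong (π ⟨$⟩ʳ_))
            | dec-true ((π ⟨$⟩ʳ j) <? (π ⟨$⟩ʳ i)) lt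
            | dec-false ((π ⟨$⟩ʳ i) <? (π ⟨$⟩ʳ j)) gt = sym (+-identityʳ x)
    ... | tri> lt ne gt
      rewrite dec-false (j ≟ i) (ne ∘ ≡.cong (π ⟨$⟩ʳ_))
            | dec-false ((π ⟨$⟩ʳ j) <? (π ⟨$⟩ʳ i)) lt
            | dec-true ((π ⟨$⟩ʳ i) <? (π ⟨$⟩ʳ j)) gt = sym (+-identityˡ x)
    -- Equal positions force equal buyers because `π` has an inverse.
    ... | tri≈ lt eq gt
      rewrite dec-true (j ≟ i) (≡.trans (≡.sym (inverseˡ π)) (≡.trans (≡.cong (π ⟨$⟩ˡ_) eq) (inverseˡ π)))
            | dec-false ((π ⟨$⟩ʳ j) <? (π ⟨$⟩ʳ i)) lt
            | dec-false ((π ⟨$⟩ʳ i) <? (π ⟨$⟩ʳ j)) gt = sym (+-identityʳ 0#)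

    module _ (q : Fin n → Carrier) where

      pair : Fin n → Fin n → Carrier
      pair i j = w j i * pairRevenue (q i) (q j)

      expected : Carrier
      expected = sum λ i → w i i * (1# - q i) + sum λ j → unless (does (j ≟ i)) (pair i j)

      mix-share : ∀ a b → mix a (λ c → mix b (share c)) ≈ pairRevenue a b
      mix-share a b = trans (+-cong (*-congˡ (trans (+-comm _ _) (+-congʳ (*-identityʳ b))))
        (trans (*-congˡ (mix-const b 0#)) (zeroʳ a))) (+-identityʳ _)

      𝔼-pair : ∀ i j → 𝔼 q (λ A → unless (does (j ≟ i)) (w j i * share (lookup A i) (lookup A j)))
                       ≈ unless (does (j ≟ i)) (pair i j)
      𝔼-pair i j with j ≟ i
      ... | yes _   = 𝔼-const q 0#
      ... | no  j≢i = trans (𝔼-* q (w j i) _)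
        (*-congˡ (trans (𝔼-lookup₂ q share (j≢i ∘ ≡.sym)) (mix-share (q i) (q j))))

      𝔼-loop : ∀ i → 𝔼 q (λ A → w i i * unless (lookup A i) 1#) ≈ w i i * (1# - q i)
      𝔼-loop i = trans (𝔼-* q (w i i) _) (*-congˡ (trans (𝔼-lookup q (λ b → unless b 1#) i)
        (trans (+-cong (*-identityʳ _) (zeroʳ (q i))) (+-identityʳ _))))

      𝔼-R-IE : 𝔼 q (λ A → R-IE G A ⟦ p₀ ⟧) ≈ ⟦ p₀ ⟧ * (1# - ⟦ p₀ ⟧) * expected
      𝔼-R-IE = trans (𝔼-cong q λ A → *-congˡ (sum-cong-≋ (IE-term A)))
        (trans (𝔼-* q _ _) (*-congˡ (trans (𝔼-sum q n _) (sum-cong-≋ λ i →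
          trans (𝔼-+ q _ _) (+-cong (𝔼-loop i) (trans (𝔼-sum q n _) (sum-cong-≋ (𝔼-pair i))))))))

      ordered : Permutation′ n → Fin n → Fin n → Carrier
      ordered π i j = if precedes π j i then pair i j + pair j i else 0#

      -- The left side meets every pair of buyers in both directions. Exchanging the summation
      -- indices in the half where `i` comes first credits both terms to the later buyer, as the
      -- revenue of a strategy does with its edges.
      ∑-pairs : ∀ π → sum (λ i → sum λ j → unless (does (j ≟ i)) (pair i j))
                      ≈ sum λ i → sum (ordered π i)
      ∑-pairs π = trans (trans
        (sum-cong-≋ λ i → trans (sum-cong-≋ λ j → split-by-order π i j (pair i j)) (∑-distrib-+ {n} _ _))
        (∑-distrib-+ {n} _ _))
        (trans (+-congˡ (∑-comm {n} {n} _))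
        (trans (sym (∑-distrib-+ {n} _ _)) (sum-cong-≋ λ i →
          trans (sym (∑-distrib-+ {n} _ _)) (sum-cong-≋ λ j → join (precedes π j i)))))
        where
        join : ∀ b {x y} → (if b then x else 0#) + (if b then y else 0#) ≈ (if b then x + y else 0#)
        join true  = refl
        join false = +-identityʳ 0#

      expected-ordered : ∀ π → expected ≈ sum λ i → w i i * (1# - q i) + sum (ordered π i)
      expected-ordered π = trans (∑-distrib-+ {n} _ _)
        (trans (+-congˡ (∑-pairs π)) (sym (∑-distrib-+ {n} _ _)))

    -- Comparison with the revenue of a given strategy.

    module _ (s : Strategy n) where
      open Strategy s

      p-valid : ∀ i → ⟦ ℚ.½ ⟧ ≤ p i × p i ≤ 1#
      p-valid i = ≡.subst (_≤ p i) (/≡⟦⟧ 1 1) (proj₁ (valid i)) , proj₂ (valid i)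

      q : Fin n → Carrier
      q i = proj₁ (influence (p i))

      q-influence : ∀ i → Influence (p i) (q i)
      q-influence i = proj₂ (influence (p i))

      q≤1 : ∀ i → q i ≤ 1#
      q≤1 i = 0≤y-x⇒x≤y (≤-trans (⟦⟧-nonneg ρ)
        (ρ≤1-a (proj₁ (p-valid i)) (proj₂ (p-valid i)) (q-influence i)))

      loop-≤ : ∀ i → ⟦ γ ⟧ * (p i * (1# - p i) * w i i) ≤ ⟦ κ ⟧ * (w i i * (1# - q i))
      loop-≤ i = begin
        ⟦ γ ⟧ * (p i * (1# - p i) * w i i)  ≈⟨ *-assoc _ _ _ ⟨
        ⟦ γ ⟧ * (p i * (1# - p i)) * w i i  ≈⟨ *-comm _ _ ⟩
        w i i * (⟦ γ ⟧ * (p i * (1# - p i)))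
          ≤⟨ *-monoʳ-≤ (w-nonneg i i)
               (loop-bound (proj₁ (p-valid i)) (proj₂ (p-valid i)) (q-influence i)) ⟩
        w i i * (⟦ κ ⟧ * (1# - q i))        ≈⟨ x∙yz≈y∙xz _ _ _ ⟩
        ⟦ κ ⟧ * (w i i * (1# - q i))        ∎

      -- In `edge-bound` the earlier buyer `j` supplies `x` and `a`, and the later buyer `i`
      -- supplies `y` and `b`. Symmetry of `w` lets one weight serve both directions.
      edge-≤ : ∀ i j → ⟦ γ ⟧ * (p i * (1# - p i) * (p j * w j i)) ≤ ⟦ κ ⟧ * (pair q i j + pair q j i)
      edge-≤ i j = begin
        ⟦ γ ⟧ * (p i * (1# - p i) * (p j * w j i))  ≈⟨ *-congˡ (*-assoc _ _ _) ⟨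
        ⟦ γ ⟧ * (p i * (1# - p i) * p j * w j i)    ≈⟨ *-assoc _ _ _ ⟨
        ⟦ γ ⟧ * (p i * (1# - p i) * p j) * w j i    ≈⟨ *-comm _ _ ⟩
        w j i * (⟦ γ ⟧ * (p i * (1# - p i) * p j))
          ≤⟨ *-monoʳ-≤ (w-nonneg j i) (edge-bound
               (proj₁ (p-valid j)) (proj₂ (p-valid j)) (q-influence j)
               (proj₁ (p-valid i)) (proj₂ (p-valid i)) (q-influence i)) ⟩
        w j i * (⟦ κ ⟧ * (pairRevenue (q i) (q j) + pairRevenue (q j) (q i)))
          ≈⟨ x∙yz≈y∙xz _ _ _ ⟩
        ⟦ κ ⟧ * (w j i * (pairRevenue (q i) (q j) + pairRevenue (q j) (q i)))
          ≈⟨ *-congˡ (trans (distribˡ _ _ _) (+-congˡ (*-congʳ (w-sym j i)))) ⟩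
        ⟦ κ ⟧ * (pair q i j + pair q j i)           ∎

      -- After `expected-ordered` both sides are indexed by a buyer and its predecessors in `π`, so
      -- they compare term by term.
      R≤expected : ⟦ γ ⟧ * R G s ≤ ⟦ κ ⟧ * expected q
      R≤expected = begin
        ⟦ γ ⟧ * R G s
          ≈⟨ *-distribˡ-sum {n} ⟦ γ ⟧ _ ⟩
        sum (λ i → ⟦ γ ⟧ * (p i * (1# - p i) * (w i i + sum (T i))))
          ≤⟨ sum-mono buyer-≤ ⟩
        sum (λ i → ⟦ κ ⟧ * (w i i * (1# - q i) + sum (ordered q π i)))
          ≈⟨ *-distribˡ-sum {n} ⟦ κ ⟧ _ ⟨
        ⟦ κ ⟧ * sum (λ i → w i i * (1# - q i) + sum (ordered q π i))
          ≈⟨ *-congˡ (expected-ordered q π) ⟨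
        ⟦ κ ⟧ * expected q ∎
        where
        T : Fin n → Fin n → Carrier
        T i j = if precedes π j i then p j * w j i else 0#

        pair-≤ : ∀ i j → ⟦ γ ⟧ * (p i * (1# - p i) * T i j) ≤ ⟦ κ ⟧ * ordered q π i j
        pair-≤ i j with precedes π j i
        ... | true  = edge-≤ i j
        ... | false = ≤-reflexive
          (trans (*-congˡ (zeroʳ _)) (trans (zeroʳ ⟦ γ ⟧) (sym (zeroʳ ⟦ κ ⟧))))

        buyer-≤ : ∀ i → ⟦ γ ⟧ * (p i * (1# - p i) * (w i i + sum (T i)))
                        ≤ ⟦ κ ⟧ * (w i i * (1# - q i) + sum (ordered q π i))
        buyer-≤ i = begin
          ⟦ γ ⟧ * (P * (w i i + sum (T i)))
            ≈⟨ trans (*-congˡ (distribˡ P _ _)) (distribˡ ⟦ γ ⟧ _ _) ⟩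
          ⟦ γ ⟧ * (P * w i i) + ⟦ γ ⟧ * (P * sum (T i))
            ≈⟨ +-congˡ (trans (*-congˡ (*-distribˡ-sum P (T i))) (*-distribˡ-sum {n} ⟦ γ ⟧ _)) ⟩
          ⟦ γ ⟧ * (P * w i i) + sum (λ j → ⟦ γ ⟧ * (P * T i j))
            ≤⟨ +-mono-≤ (loop-≤ i) (sum-mono (pair-≤ i)) ⟩
          ⟦ κ ⟧ * (w i i * (1# - q i)) + sum (λ j → ⟦ κ ⟧ * ordered q π i j)
            ≈⟨ trans (distribˡ ⟦ κ ⟧ _ _) (+-congˡ (*-distribˡ-sum ⟦ κ ⟧ (ordered q π i))) ⟨
          ⟦ κ ⟧ * (w i i * (1# - q i) + sum (ordered q π i)) ∎
          where
          P : Carrier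
          P = p i * (1# - p i)

      -- Proved for any strategy `s`; `theorem1` applies it to a maximising one.
      IE-approximates : ∃ λ A → ⟦ γ ⟧ * R G s ≤ R-IE G A ⟦ p₀ ⟧
      IE-approximates =
        let A , 𝔼≤ = 𝔼-attained q (λ A → R-IE G A ⟦ p₀ ⟧) (λ i → Influence.nonneg (q-influence i)) q≤1
        in A , (begin
          ⟦ γ ⟧ * R G s                          ≤⟨ R≤expected ⟩
          ⟦ κ ⟧ * expected q                     ≈⟨ *-congʳ κ≈p₀[1-p₀] ⟩
          ⟦ p₀ ⟧ * (1# - ⟦ p₀ ⟧) * expected q    ≈⟨ 𝔼-R-IE q ⟨
          𝔼 q (λ A → R-IE G A ⟦ p₀ ⟧)            ≤⟨ 𝔼≤ ⟩
          R-IE G A ⟦ p₀ ⟧                        ∎)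

theorem1 : (ℝ : CompleteOrderedField) →
    let open CompleteOrderedField ℝ
        open Revenue ℝ
    in {n : ℕ} (G : SocialNetwork ℝ n) →
       ∃ λ (A : Subset n) → (9111 / 10000) * R-max G ≤ R-IE G A (586 / 1000)
theorem1 ℝ G =
  let (s , Rs≈max) , _ = R-max-isMaximum G
      A , γR≤R-IE = IE-approximates ℝ G s
  -- `mkℚᵘ` stores the denominator minus one, hence 9999 and 999.
  in A , ≡.subst₂ (λ c p → c * R-max G ≤ R-IE G A p) (≡.sym (/≡⟦⟧ 9111 9999)) (≡.sym (/≡⟦⟧ 586 999))
           (≤-trans (≤-reflexive (*-congˡ (sym Rs≈max))) γR≤R-IE)
  where
  open OrderedField ℝ
  open Revenue ℝ
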